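{- Let $\varphi$ be a minimal counterexample to Vaught's conjecture and let $\lambda\in S^\circ=\mathfrak F\cap C_{5.3}\cap(\mathrm{qr}(\varphi),\omega_1)$. Then every fiber model $M$ at $\lambda$ (i.e. every countable $M\models T_\lambda$ with $\omega_1^M=\lambda$) lies in $\mathcal C_\lambda$; equivalently, $M\equiv_\lambda B_\lambda$ for every fiber model $M$. Thus all fiber models at $\lambda$ lie in a single $\equiv_\lambda$-class.
   Context: Structures are countable structures in a countable vocabulary; classes of models are counted up to isomorphism. $\Sigma^{\mathrm{in}}_0=\Pi^{\mathrm{in}}_0$ is the set of finitary quantifier-free formulas; for $\alpha>0$, $\Sigma^{\mathrm{in}}_\alpha$ consists of countable disjunctions of formulas $\exists\bar x\,\psi$ with $\psi\in\Pi^{\mathrm{in}}_\beta$, $\beta<\alpha$, and $\Pi^{\mathrm{in}}_\alpha$ is dual. $M\equiv_\alpha N$: $M,N$ satisfy the same $\Pi^{\mathrm{in}}_\alpha$ (equivalently $\Sigma^{\mathrm{in}}_\alpha$) sentences. A Scott sentence of $M$ is an $L_{\omega_1\omega}$ sentence whose countable models are exactly the copies of $M$. $\mathrm{cSR}(M)$: the least $\alpha$ such that $M$ has a $\Pi^{\mathrm{in}}_{\alpha+1}$ Scott sentence. $\omega_1^A=\min\{\omega_1^X: X\in 2^\omega\text{ computes a copy of }A\}$. $\mathrm{qr}(S)$: the least $\beta$ with $S\in\Pi^{\mathrm{in}}_\beta\cup\Sigma^{\mathrm{in}}_\beta$. Standing hypotheses: Vaught's conjecture fails, and $\varphi$ is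 a minimal counterexample: an $L_{\omega_1\omega}$ sentence with exactly $\aleph_1$ countable models up to isomorphism, scattered (for each $\alpha<\omega_1$ at most countably many $\equiv_\alpha$-classes among its models), and such that for every $L_{\omega_1\omega}$ sentence $\psi$ one of $\varphi\wedge\psi$, $\varphi\wedge\neg\psi$ has only countably many models. Moreover for each $\alpha<\omega_1$ only countably many $\Sigma^{\mathrm{in}}_\alpha$-types are realized in models of $\varphi$. For each $\beta<\omega_1$ exactly one $\equiv_\beta$-class of models of $\varphi$ is uncountable, denoted $\mathcal C_\beta$. $f(\alpha)=\min\{\beta:(\forall M\models\varphi)(M\notin\mathcal C_\alpha\Rightarrow\mathrm{cSR}(M)<\beta)\}$, $\mathfrak F=\{\alpha<\omega_1:f(\alpha)\le\alpha\}$. Sacks rank. A fragment is a countable set of $L_{\omega_1\omega}$ formulas closed under subformulas, substitution and the finitary connectives and quantifiers. For a structure $A$: $L^A_0$ is the finitary language; $T^A_\delta=\mathrm{Th}_{L^A_\delta}(A)$; $L^A_{\delta+1}$ is the least fragment containing $L^A_\delta$ and $\bigwedge p$ for every non-principal complete $L^A_\delta$-type $p$ realized in $A$; unions at limits. $\mathrm{sr}_{\mathrm{Sacks}}(A)$ is the least $\delta$ such that $A$ is the atomic model of $T^A_\delta$. Tree of nodes. $L_0$ is the fragment generated by $\varphi$, and $T$ is $\{\varphi\}$ together with the tautologies of $L_0$. A theory $T'$ in a fragment $L'$ is $\omega$-complete if for each sentence $F\in L'$, $F\in T'$ or $\neg F\in T'$, and whenever $\bigvee_iF_i\in T'$, some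 $F_i\in T'$; it is finitarily consistent if no contradiction is derivable from it by finite-length deductions. Nodes on level $0$: finitarily consistent $\omega$-complete extensions of $T$ in $L_0$. An $n$-type of a node $S$ (in fragment $L_S$) is a maximal set of $L_S(\bar x)$-formulas finitarily consistent with $S$; it is principal if generated over $S$ by one of its formulas. Nodes on level $\delta+1$: finitarily consistent $\omega$-complete extensions of a level-$\delta$ node $S$ in $L'_S$, the least fragment containing $L_S$ and $\bigwedge p$ for each non-principal $n$-type $p$ of $S$. Nodes on limit levels: unions along chains. Every model of a node is a model of $\varphi$. Fixed data, supplied by theorems of Sacks (Bounds on weak scattering, Thm. 4.9, Prop. 5.2 and Thm. 5.3): an increasing branch $(T_\delta)_{\delta<\omega_1}$ of nodes, $T_\delta$ on level $\delta$, unions at limits, $\Delta_1$ over $L(\omega_1,T)$, such that every $T_\delta$ has an atomic model $A_\delta$ of $\mathrm{sr}_{\mathrm{Sacks}}$ exactly $\delta$, and $A_{\delta+1}$ realizes a non-principal type of $T_\delta$; and a club $C_{5.3}\subseteq\omega_1$ (the ordinals $\omega_1^{L(\beta_\delta,T)}$ for the transitive collapses $L(\beta_\delta,T)$ of the $\Sigma_1$-hulls in Sacks' proof) such that for each $\lambda\in C_{5.3}$: $\lambda>\omega$ and $L(\lambda,T)$ is $\Sigma_1$-admissible; $B_\lambda\models T_\lambda$ realizes every non-principal $n$-type of $T_\lambda$, $\omega_1^{B_\lambda}=\lambda$ and $\mathrm{sr}_{\mathrm{Sacks}}(B_\lambda)=\lambda+1$.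
   Formalization: The n-types of a node are additionally required to contain some disjunct of each disjunction they contain; with types only maximal finitarily consistent, no model could realize every non-principal type of T_λ. -}

module Defs where

open import Data.Bool using (Bool; true; false; T; if_then_else_)
open import Data.Empty using (⊥)
open import Data.Fin using (Fin; zero; suc)
open import Data.List using (List; []; _∷_)
import Data.List as List
open import Data.List.Membership.Propositional using (_∈_)
open import Data.List.Relation.Unary.All using (All)
open import Data.Maybe using (Maybe; just; nothing)
open import Data.Nat using (ℕ; zero; suc; _+_; _*_)
import Data.Nat as ℕ
open import Data.Product using (Σ; Σ-syntax; ∃; ∃-syntax; _×_; _,_; proj₁; proj₂)
open import Data.Sum using (_⊎_)
open import Data.Vec using (Vec; []; _∷_; lookup)
import Data.Vec as Vec
open import Function using (_∘_)
open import Function.Bundles using (_↣_; _↔_; _⇔_; module Injection; module Inverse)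
open import Level using (0ℓ)
open import Relation.Binary.PropositionalEquality using (_≡_)
open import Relation.Nullary using (¬_)
open import Relation.Unary using (Pred; _⊆_; _≐_; _∪_; ∅; ｛_｝)

-- Brouwer trees; lim f is the supremum of an arbitrary sequence.  Read
-- classically, the quotient of Ord by _≈ₒ_, ordered by _<_, is ω₁.  A
-- tree of the form lim f may denote zero or a successor, so "limit" is
-- the semantic notion IsLimit.

data Ord : Set where
  zero : Ord
  suc  : Ord → Ord
  lim  : (ℕ → Ord) → Ord

infix 4 _≤_ _<_ _≈ₒ_

data _≤_ : Ord → Ord → Set
data _<_ : Ord → Ord → Set

data _≤_ where
  zero≤ : ∀ {β} → zero ≤ β
  suc≤  : ∀ {α β} → α < β → suc α ≤ β
  lim≤  : ∀ {f β} → (∀ i → f i ≤ β) → lim f ≤ β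

data _<_ where
  <suc : ∀ {α β} → α ≤ β → α < suc β
  <lim : ∀ {α f} i → α < f i → α < lim f

_≈ₒ_ : Ord → Ord → Set
α ≈ₒ β = α ≤ β × β ≤ α

IsLimit : Ord → Set
IsLimit α = zero < α × (∀ {β} → β < α → suc β < α)

IsLeast : Pred Ord 0ℓ → Pred Ord 0ℓ
IsLeast P α = P α × (∀ {β} → P β → α ≤ β)

fromℕ : ℕ → Ord
fromℕ zero    = zero
fromℕ (suc n) = suc (fromℕ n)

ω : Ord
ω = lim fromℕ

record IsClub (C : Pred Ord 0ℓ) : Set where
  field
    resp      : ∀ {α β} → α ≈ₒ β → C α → C β
    unbounded : ∀ α → ∃[ γ ] α < γ × C γ
    closed    : ∀ {α} → IsLimit α →
                (∀ {β} → β < α → ∃[ γ ] β < γ × γ < α × C γ) → C α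

data Prog : ℕ → Set where
  zeroᵖ  : ∀ {n} → Prog n
  sucᵖ   : Prog 1
  projᵖ  : ∀ {n} → Fin n → Prog n
  oracle : Prog 1
  comp   : ∀ {m n} → Prog m → Vec (Prog n) m → Prog n
  rec    : ∀ {n} → Prog n → Prog (2 + n) → Prog (1 + n)
  μ      : ∀ {n} → Prog (1 + n) → Prog n

bit : Bool → ℕ
bit b = if b then 1 else 0

data Eval (X : ℕ → Bool) : ∀ {n} → Prog n → Vec ℕ n → ℕ → Set where
  zeroᵖ  : ∀ {n} {xs : Vec ℕ n} → Eval X zeroᵖ xs 0
  sucᵖ   : ∀ {x} → Eval X sucᵖ (x ∷ []) (suc x)
  projᵖ  : ∀ {n} {xs : Vec ℕ n} i → Eval X (projᵖ i) xs (lookup xs i)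
  oracle : ∀ {x} → Eval X oracle (x ∷ []) (bit (X x))
  comp   : ∀ {m n} {p : Prog m} {qs : Vec (Prog n) m} {xs y} (zs : Vec ℕ m) →
           (∀ i → Eval X (lookup qs i) xs (lookup zs i)) →
           Eval X p zs y → Eval X (comp p qs) xs y
  rec-0  : ∀ {n} {p : Prog n} {q xs y} →
           Eval X p xs y → Eval X (rec p q) (0 ∷ xs) y
  rec-s  : ∀ {n} {p : Prog n} {q xs k z y} →
           Eval X (rec p q) (k ∷ xs) z → Eval X q (k ∷ z ∷ xs) y →
           Eval X (rec p q) (suc k ∷ xs) y
  μ      : ∀ {n} {p : Prog (1 + n)} {xs y} →
           (∀ k → k ℕ.< y → ∃[ z ] Eval X p (k ∷ xs) (suc z)) →
           Eval X p (y ∷ xs) 0 → Eval X (μ p) xs y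

Computes : (X : ℕ → Bool) → ∀ {n} → Pred (Vec ℕ n) 0ℓ → Set
Computes X {n} P = Σ[ p ∈ Prog n ] ∀ xs →
  (P xs → Eval X p xs 1) × (¬ P xs → Eval X p xs 0)

-- The relation R on the set D is isomorphic to ({ β | β < α } , <).
HasOrderType : (D : ℕ → Bool) (R : ℕ → ℕ → Bool) → Ord → Set
HasOrderType D R α = Σ[ r ∈ (ℕ → Ord) ]
    (∀ m → T (D m) → r m < α)
  × (∀ {β} → β < α → ∃[ m ] T (D m) × r m ≈ₒ β)
  × (∀ m n → T (D m) → T (D n) →
       (T (R m n) ⇔ r m < r n) × (r m ≈ₒ r n → m ≡ n))

IsComputableOrdinal : (X : ℕ → Bool) → Pred Ord 0ℓ
IsComputableOrdinal X α =
  Σ[ D ∈ (ℕ → Bool) ] Σ[ R ∈ (ℕ → ℕ → Bool) ]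
    Computes X (λ (xs : Vec ℕ 1) → T (D (lookup xs zero)))
  × Computes X (λ (xs : Vec ℕ 2) → T (R (lookup xs zero) (lookup xs (suc zero))))
  × HasOrderType D R α

Isω₁ : (X : ℕ → Bool) → Pred Ord 0ℓ
Isω₁ X = IsLeast (λ α → ¬ IsComputableOrdinal X α)

record Vocabulary : Set₁ where
  field
    Rel Fun  : Set
    relArity : Rel → ℕ
    funArity : Fun → ℕ
    relCode  : Rel ↣ ℕ
    funCode  : Fun ↣ ℕ

open Vocabulary public

variable
  τ : Vocabulary

-- Countable structures, finite or infinite: the universe is a nonempty
-- subset of ℕ.  Every countable structure has a copy of this form.
record Structure (τ : Vocabulary) : Set where
  field
    dom : ℕ → Bool
  Elem : Set
  Elem = Σ[ a ∈ ℕ ] T (dom a)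
  field
    point : Elem
    rel   : (R : Rel τ) → Vec Elem (relArity τ R) → Bool
    fun   : (g : Fun τ) → Vec Elem (funArity τ g) → Elem

open Structure public

infix 4 _≅_

record _≅_ {τ : Vocabulary} (M N : Structure τ) : Set where
  field
    bijection : Elem M ↔ Elem N
  to : Elem M → Elem N
  to = Inverse.to bijection
  field
    rel-pres : ∀ R v → rel M R v ≡ rel N R (Vec.map to v)
    fun-pres : ∀ g v → to (fun M g v) ≡ fun N g (Vec.map to v)

-- Injective, since (m + n)² ≤ pair m n < (m + n + 1)².
pair : ℕ → ℕ → ℕ
pair m n = (m + n) * (m + n) + m

codeVec : ∀ {n} → Vec ℕ n → ℕ
codeVec []       = 0
codeVec (x ∷ xs) = pair x (codeVec xs)

data Diagram {τ : Vocabulary} (M : Structure τ) : Pred ℕ 0ℓ where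
  in-dom : (a : Elem M) → Diagram M (pair 0 (proj₁ a))
  holds  : ∀ R v → T (rel M R v) →
           Diagram M (pair 1 (pair (Injection.to (relCode τ) R)
                                   (codeVec (Vec.map proj₁ v))))
  value  : ∀ g v →
           Diagram M (pair 2 (pair (Injection.to (funCode τ) g)
                                   (pair (codeVec (Vec.map proj₁ v))
                                         (proj₁ (fun M g v)))))

ComputesCopy : (X : ℕ → Bool) → Structure τ → Set
ComputesCopy {τ} X M = Σ[ N ∈ Structure τ ]
  (N ≅ M) × Computes X (λ (xs : Vec ℕ 1) → Diagram N (lookup xs zero))

Isω₁Of : Structure τ → Pred Ord 0ℓ
Isω₁Of M = IsLeast (λ α → ∃[ X ] ComputesCopy X M × Isω₁ X α)

data Term (τ : Vocabulary) (n : ℕ) : Set where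
  var : Fin n → Term τ n
  app : (g : Fun τ) → Vec (Term τ n) (funArity τ g) → Term τ n

-- Fm τ n: formulas with free (de Bruijn) variables among n.  The
-- primitives are ⊥, =, R, ¬, ∧, ⋁, ∃; the other connectives are
-- abbreviations, so ⋀ f is ¬ ⋁ᵢ ¬ f i.
data Fm (τ : Vocabulary) (n : ℕ) : Set where
  ⊥'   : Fm τ n
  _≐'_ : Term τ n → Term τ n → Fm τ n
  rel' : (R : Rel τ) → Vec (Term τ n) (relArity τ R) → Fm τ n
  ¬'_  : Fm τ n → Fm τ n
  _∧'_ : Fm τ n → Fm τ n → Fm τ n
  ⋁    : (ℕ → Fm τ n) → Fm τ n
  ∃'_  : Fm τ (suc n) → Fm τ n

infix  8 _≐'_
infix  7 ¬'_ ∃'_ ∀'_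
infixr 6 _∧'_

∀'_ : ∀ {n} → Fm τ (suc n) → Fm τ n
∀' F = ¬' (∃' (¬' F))

⋀ : ∀ {n} → (ℕ → Fm τ n) → Fm τ n
⋀ f = ¬' (⋁ (λ i → ¬' (f i)))

∃* ∀* : ∀ k {n} → Fm τ (k + n) → Fm τ n
∃* zero    F = F
∃* (suc k) F = ∃* k (∃' F)
∀* zero    F = F
∀* (suc k) F = ∀* k (∀' F)

Sentence : Vocabulary → Set
Sentence τ = Fm τ 0

-- ⋁ f is the disjunction of the *set* { f i }: formulas are identified
-- when they differ only in the enumeration of their disjunctions.
infix 4 _≈_

data _≈_ {τ : Vocabulary} {n : ℕ} : Fm τ n → Fm τ n → Set where
  ⊥≈   : ⊥' ≈ ⊥'
  ≐≈   : ∀ {s t} → s ≐' t ≈ s ≐' t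
  rel≈ : ∀ {R ts} → rel' R ts ≈ rel' R ts
  ¬≈   : ∀ {F G} → F ≈ G → ¬' F ≈ ¬' G
  ∧≈   : ∀ {F F' G G'} → F ≈ F' → G ≈ G' → F ∧' G ≈ F' ∧' G'
  ⋁≈   : ∀ {f g} → (∀ i → ∃[ j ] f i ≈ g j) → (∀ j → ∃[ i ] f i ≈ g j) →
         ⋁ f ≈ ⋁ g
  ∃≈   : ∀ {F G} → F ≈ G → ∃' F ≈ ∃' G

Subst : Vocabulary → ℕ → ℕ → Set
Subst τ n m = Fin n → Term τ m

substT  : ∀ {n m} → Subst τ n m → Term τ n → Term τ m
substTs : ∀ {n m k} → Subst τ n m → Vec (Term τ n) k → Vec (Term τ m) k
substT σ (var i)    = σ i
substT σ (app g ts) = app g (substTs σ ts)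
substTs σ []       = []
substTs σ (t ∷ ts) = substT σ t ∷ substTs σ ts

wkσ : ∀ {n} → Subst τ n (suc n)
wkσ i = var (suc i)

lift : ∀ {n m} → Subst τ n m → Subst τ (suc n) (suc m)
lift σ zero    = var zero
lift σ (suc i) = substT wkσ (σ i)

subst : ∀ {n m} → Subst τ n m → Fm τ n → Fm τ m
subst σ ⊥'         = ⊥'
subst σ (s ≐' t)   = substT σ s ≐' substT σ t
subst σ (rel' R ts) = rel' R (substTs σ ts)
subst σ (¬' F)     = ¬' (subst σ F)
subst σ (F ∧' G)   = subst σ F ∧' subst σ G
subst σ (⋁ f)      = ⋁ (λ i → subst σ (f i))
subst σ (∃' F)     = ∃' (subst (lift σ) F)

wk : ∀ {n} → Fm τ n → Fm τ (suc n)
wk = subst wkσ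

inst : ∀ {n} → Term τ n → Subst τ (suc n) n
inst t zero    = t
inst t (suc i) = var i

_[_] : ∀ {n} → Fm τ (suc n) → Term τ n → Fm τ n
F [ t ] = subst (inst t) F

module _ (M : Structure τ) where

  evalT  : ∀ {n} → Vec (Elem M) n → Term τ n → Elem M
  evalTs : ∀ {n k} → Vec (Elem M) n → Vec (Term τ n) k → Vec (Elem M) k
  evalT a (var i)    = lookup a i
  evalT a (app g ts) = fun M g (evalTs a ts)
  evalTs a []       = []
  evalTs a (t ∷ ts) = evalT a t ∷ evalTs a ts

  Sat : ∀ {n} → Fm τ n → Vec (Elem M) n → Set
  Sat ⊥'         a = ⊥
  Sat (s ≐' t)   a = evalT a s ≡ evalT a t
  Sat (rel' R ts) a = T (rel M R (evalTs a ts))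
  Sat (¬' F)     a = ¬ Sat F a
  Sat (F ∧' G)   a = Sat F a × Sat G a
  Sat (⋁ f)      a = ∃[ i ] Sat (f i) a
  Sat (∃' F)     a = Σ[ b ∈ Elem M ] Sat F (b ∷ a)

infix 4 _⊨_

_⊨_ : Structure τ → Sentence τ → Set
M ⊨ F = Sat M F []

data QuantifierFree {τ : Vocabulary} {n : ℕ} : Pred (Fm τ n) 0ℓ where
  ⊥'   : QuantifierFree ⊥'
  _≐'_ : ∀ s t → QuantifierFree (s ≐' t)
  rel' : ∀ R ts → QuantifierFree (rel' R ts)
  ¬'_  : ∀ {F} → QuantifierFree F → QuantifierFree (¬' F)
  _∧'_ : ∀ {F G} → QuantifierFree F → QuantifierFree G → QuantifierFree (F ∧' G)

-- Empty disjunctions are covered by ⊥' at level 0.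
data Σin {τ : Vocabulary} : Ord → ∀ {n} → Pred (Fm τ n) 0ℓ
data Πin {τ : Vocabulary} : Ord → ∀ {n} → Pred (Fm τ n) 0ℓ

data Σin {τ} where
  qf   : ∀ {α n} {F : Fm τ n} → α ≤ zero → QuantifierFree F → Σin α F
  disj : ∀ {α n} {f : ℕ → Fm τ n} →
         (∀ i → ∃[ β ] β < α × (∃[ k ] Σ[ G ∈ Fm τ (k + n) ]
                  Πin β G × f i ≡ ∃* k G)) →
         Σin α (⋁ f)

data Πin {τ} where
  qf   : ∀ {α n} {F : Fm τ n} → α ≤ zero → QuantifierFree F → Πin α F
  conj : ∀ {α n} {f : ℕ → Fm τ n} →
         (∀ i → ∃[ β ] β < α × (∃[ k ] Σ[ G ∈ Fm τ (k + n) ]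
                  Σin β G × f i ≡ ∀* k G)) →
         Πin α (⋀ f)

infix 4 _≡[_]_

_≡[_]_ : Structure τ → Ord → Structure τ → Set
M ≡[ α ] N = ∀ F → Πin α F → (M ⊨ F ⇔ N ⊨ F)

IsScottSentence : Structure τ → Pred (Sentence τ) 0ℓ
IsScottSentence M F = ∀ N → (N ⊨ F ⇔ N ≅ M)

IscSR : Structure τ → Pred Ord 0ℓ
IscSR M = IsLeast (λ α → ∃[ F ] Πin (suc α) F × IsScottSentence M F)

-- The hierarchy is one of normal forms, so membership of a sentence in
-- a level is taken up to logical equivalence.
IsQR : Sentence τ → Pred Ord 0ℓ
IsQR {τ} S = IsLeast (λ β → Σ[ F ∈ Sentence τ ]
  (Πin β F ⊎ Σin β F) × (∀ M → M ⊨ S ⇔ M ⊨ F))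

CountablyMany : (Structure τ → Structure τ → Set) → Pred (Structure τ) 0ℓ → Set
CountablyMany {τ} _∼_ K =
  Σ[ e ∈ (ℕ → Structure τ) ] (∀ M → K M → ∃[ i ] M ∼ e i)

𝒞 : Sentence τ → Ord → Pred (Structure τ) 0ℓ
𝒞 φ α M = M ⊨ φ × ¬ CountablyMany _≅_ (λ N → N ⊨ φ × N ≡[ α ] M)

record MinimalCounterexample (τ : Vocabulary) (φ : Sentence τ) : Set where
  -- The class Ord / ≈ₒ, in bijection with the models up to ≅, is ω₁.
  field
    ℵ₁-many :
      Σ[ e ∈ (Ord → Structure τ) ]
        (∀ α → e α ⊨ φ)
      × (∀ M → M ⊨ φ → ∃[ α ] M ≅ e α)
      × (∀ α β → (e α ≅ e β ⇔ α ≈ₒ β))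
    scattered :
      ∀ α → CountablyMany _≡[ α ]_ (_⊨ φ)
    minimal :
      ∀ ψ → CountablyMany _≅_ (_⊨ (φ ∧' ψ))
          ⊎ CountablyMany _≅_ (_⊨ (φ ∧' ¬' ψ))
    countably-many-types :
      ∀ α n →
      Σ[ e ∈ (ℕ → Σ[ M ∈ Structure τ ] Vec (Elem M) n) ]
        (∀ M → M ⊨ φ → (a : Vec (Elem M) n) →
         ∃[ i ] ∀ F → Σin α F →
           (Sat M F a ⇔ Sat (proj₁ (e i)) F (proj₂ (e i))))
    𝒞-inhabited : ∀ β → ∃[ M ] 𝒞 φ β M
    𝒞-unique    : ∀ β M N → 𝒞 φ β M → 𝒞 φ β N → M ≡[ β ] N

IsF : Sentence τ → Ord → Pred Ord 0ℓ
IsF φ α = IsLeast (λ β →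
  ∀ M → M ⊨ φ → ¬ 𝒞 φ α M → ∃[ γ ] IscSR M γ × γ < β)

𝔉 : Sentence τ → Pred Ord 0ℓ
𝔉 φ α = ∃[ β ] IsF φ α β × β ≤ α

-- Natural deduction for L_{ω₁ω} with every rule having finitely many
-- premises: the only rule omitted is the infinitary one, concluding
-- from premises for all i ∈ ℕ (elimination of ⋁, i.e. introduction of
-- ⋀).  Universes are nonempty.
infix 3 _⊢_ _⊩_

data _⊢_ {τ : Vocabulary} : ∀ {n} → List (Fm τ n) → Fm τ n → Set where
  hyp     : ∀ {n Γ} {F : Fm τ n} → F ∈ Γ → Γ ⊢ F
  conv    : ∀ {n Γ} {F G : Fm τ n} → F ≈ G → Γ ⊢ F → Γ ⊢ G
  ¬I      : ∀ {n Γ} {F : Fm τ n} → F ∷ Γ ⊢ ⊥' → Γ ⊢ ¬' F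
  ¬E      : ∀ {n Γ} {F : Fm τ n} → Γ ⊢ ¬' F → Γ ⊢ F → Γ ⊢ ⊥'
  raa     : ∀ {n Γ} {F : Fm τ n} → ¬' F ∷ Γ ⊢ ⊥' → Γ ⊢ F
  ∧I      : ∀ {n Γ} {F G : Fm τ n} → Γ ⊢ F → Γ ⊢ G → Γ ⊢ F ∧' G
  ∧E₁     : ∀ {n Γ} {F G : Fm τ n} → Γ ⊢ F ∧' G → Γ ⊢ F
  ∧E₂     : ∀ {n Γ} {F G : Fm τ n} → Γ ⊢ F ∧' G → Γ ⊢ G
  ⋁I      : ∀ {n Γ} {f : ℕ → Fm τ n} i → Γ ⊢ f i → Γ ⊢ ⋁ f
  ∃I      : ∀ {n Γ} {F : Fm τ (suc n)} t → Γ ⊢ F [ t ] → Γ ⊢ ∃' F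
  ∃E      : ∀ {n Γ} {F : Fm τ (suc n)} {G : Fm τ n} →
            Γ ⊢ ∃' F → F ∷ List.map wk Γ ⊢ wk G → Γ ⊢ G
  ≐-refl  : ∀ {n Γ} {t : Term τ n} → Γ ⊢ t ≐' t
  ≐-subst : ∀ {n Γ} {s t : Term τ n} (F : Fm τ (suc n)) →
            Γ ⊢ s ≐' t → Γ ⊢ F [ s ] → Γ ⊢ F [ t ]
  nonempty : ∀ {n} {Γ : List (Fm τ n)} → Γ ⊢ ∃' (var zero ≐' var zero)

_⊩_ : ∀ {n} → Pred (Fm τ n) 0ℓ → Fm τ n → Set
P ⊩ F = ∃[ Γ ] All P Γ × (Γ ⊢ F)

FinitarilyConsistent : ∀ {n} → Pred (Fm τ n) 0ℓ → Set
FinitarilyConsistent P = ¬ (P ⊩ ⊥')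

Language : Vocabulary → Set₁
Language τ = ∀ n → Pred (Fm τ n) 0ℓ

-- All finitary formulas are included, not only those built from X.
data Closure {τ : Vocabulary} (X : Language τ) : Language τ where
  base  : ∀ {n F} → X n F → Closure X n F
  conv  : ∀ {n F G} → F ≈ G → Closure X n F → Closure X n G
  ⊥'    : ∀ {n} → Closure X n ⊥'
  _≐'_  : ∀ {n} s t → Closure X n (s ≐' t)
  rel'  : ∀ {n} R ts → Closure X n (rel' R ts)
  ¬'_   : ∀ {n F} → Closure X n F → Closure X n (¬' F)
  _∧'_  : ∀ {n F G} → Closure X n F → Closure X n G → Closure X n (F ∧' G)
  ∃'_   : ∀ {n F} → Closure X (suc n) F → Closure X n (∃' F)
  sub   : ∀ {n m F} (σ : Subst τ n m) → Closure X n F → Closure X m (subst σ F)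
  sub-¬ : ∀ {n F} → Closure X n (¬' F) → Closure X n F
  sub-∧₁ : ∀ {n F G} → Closure X n (F ∧' G) → Closure X n F
  sub-∧₂ : ∀ {n F G} → Closure X n (F ∧' G) → Closure X n G
  sub-⋁ : ∀ {n f} i → Closure X n (⋁ f) → Closure X n (f i)
  sub-∃ : ∀ {n F} → Closure X n (∃' F) → Closure X (suc n) F

record IsFragment {τ : Vocabulary} (L : Language τ) : Set where
  field
    closed    : ∀ n → Closure L n ⊆ L n
    countable : ∀ n → Σ[ e ∈ (ℕ → Fm τ n) ] (∀ F → L n F → ∃[ i ] F ≈ e i)

Theory : Vocabulary → Set₁
Theory τ = Pred (Sentence τ) 0ℓ

infix 4 _⊨ᵀ_

_⊨ᵀ_ : Structure τ → Theory τ → Set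
M ⊨ᵀ S = ∀ F → S F → M ⊨ F

_↑_ : Theory τ → ∀ n → Pred (Fm τ n) 0ℓ
(S ↑ n) F = ∃[ G ] S G × F ≡ subst (λ ()) G

ωProperty : ∀ {n} → Pred (Fm τ n) 0ℓ → Set
ωProperty P = ∀ f → P (⋁ f) → ∃[ i ] P (f i)

record IsωCompleteIn {τ : Vocabulary} (L : Language τ) (S : Theory τ) : Set where
  field
    inL      : S ⊆ L 0
    complete : ∀ F → L 0 F → S F ⊎ S (¬' F)
    ω-prop   : ωProperty S

-- The ω-property is part of the notion of type, as it is for theories.
-- Without it, for a non-principal realized type p with ⋀ p in the
-- fragment, p ∪ {¬ ⋀ p} would be finitarily consistent, and no structure
-- could realize all the non-principal types.
record IsType {τ : Vocabulary} (L : Language τ) (S : Theory τ)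
              {n : ℕ} (p : Pred (Fm τ n) 0ℓ) : Set where
  field
    inL        : p ⊆ L n
    consistent : FinitarilyConsistent (S ↑ n ∪ p)
    ω-prop     : ωProperty p
    maximal    : ∀ F → L n F →
                 FinitarilyConsistent (S ↑ n ∪ p ∪ ｛ F ｝) → p F

IsPrincipal : (S : Theory τ) → ∀ {n} → Pred (Fm τ n) 0ℓ → Set
IsPrincipal S {n} p =
  ∃[ θ ] p θ × (∀ ψ → p ψ → (S ↑ n ∪ ｛ θ ｝) ⊩ ψ)

tp : (L : Language τ) (M : Structure τ) → ∀ {n} → Vec (Elem M) n → Pred (Fm τ n) 0ℓ
tp L M {n} a F = L n F × Sat M F a

Th : (L : Language τ) (M : Structure τ) → Theory τ
Th L M = tp L M []

IsAtomicModel : Structure τ → Language τ → Theory τ → Set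
IsAtomicModel M L S =
  (M ⊨ᵀ S) × (∀ n (a : Vec (Elem M) n) → IsPrincipal S (tp L M a))

range : ∀ {n} → (ℕ → Fm τ n) → Pred (Fm τ n) 0ℓ
range f F = ∃[ i ] F ≈ f i

_∪ᴸ_ : Language τ → Language τ → Language τ
(L ∪ᴸ X) n = L n ∪ X n

-- Realized types are countable up to _≈_, so ⋀ p is ⋀ f for any f
-- enumerating p.
RealizedNonprincipal : (L : Language τ) (A : Structure τ) → Language τ
RealizedNonprincipal L A n F =
  Σ[ a ∈ Vec (Elem A) n ] ∃[ f ] F ≡ ⋀ f × range f ≐ tp L A a
    × ¬ IsPrincipal (Th L A) (tp L A a)

Lᴬ : Structure τ → Ord → Language τ
Lᴬ A zero    = Closure (λ _ → ∅)
Lᴬ A (suc δ) = Closure (Lᴬ A δ ∪ᴸ RealizedNonprincipal (Lᴬ A δ) A)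
Lᴬ A (lim f) = λ n F → ∃[ i ] Lᴬ A (f i) n F

IsSacksRank : Structure τ → Pred Ord 0ℓ
IsSacksRank A = IsLeast (λ δ → IsAtomicModel A (Lᴬ A δ) (Th (Lᴬ A δ) A))

L₀ : Sentence τ → Language τ
L₀ φ = Closure X
  where
  X : Language _
  X zero    = ｛ φ ｝
  X (suc _) = ∅

T₀ : Sentence τ → Theory τ
T₀ φ F = F ≈ φ ⊎ (L₀ φ 0 F × ([] ⊢ F))

Nonprincipal : (L : Language τ) (S : Theory τ) → Language τ
Nonprincipal L S n F =
  ∃[ f ] F ≡ ⋀ f × IsType L S (range f) × ¬ IsPrincipal S (range f)

L' : (L : Language τ) (S : Theory τ) → Language τ
L' L S = Closure (L ∪ᴸ Nonprincipal L S)

record IsRootNode {τ : Vocabulary} (φ : Sentence τ)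
                  (L : Language τ) (S : Theory τ) : Set where
  field
    language   : ∀ n → L n ≐ L₀ φ n
    extends    : T₀ φ ⊆ S
    consistent : FinitarilyConsistent S
    ω-complete : IsωCompleteIn L S

record IsChildNode {τ : Vocabulary} (L : Language τ) (S : Theory τ)
                   (L⁺ : Language τ) (S⁺ : Theory τ) : Set where
  field
    language   : ∀ n → L⁺ n ≐ L' L S n
    extends    : S ⊆ S⁺
    consistent : FinitarilyConsistent S⁺
    ω-complete : IsωCompleteIn L⁺ S⁺

record IsBranch {τ : Vocabulary} (φ : Sentence τ)
                (Lang : Ord → Language τ) (Thy : Ord → Theory τ) : Set where
  field
    fragment   : ∀ δ → IsFragment (Lang δ)
    root       : IsRootNode φ (Lang zero) (Thy zero)
    child      : ∀ δ → IsChildNode (Lang δ) (Thy δ) (Lang (suc δ)) (Thy (suc δ))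
    limit-lang : ∀ {δ} → IsLimit δ → ∀ n →
                 Lang δ n ≐ (λ F → ∃[ β ] β < δ × Lang β n F)
    limit-thy  : ∀ {δ} → IsLimit δ → Thy δ ≐ (λ F → ∃[ β ] β < δ × Thy β F)
    mono-lang  : ∀ {α β} → α ≤ β → ∀ n → Lang α n ⊆ Lang β n
    mono-thy   : ∀ {α β} → α ≤ β → Thy α ⊆ Thy β

-- Aczel's cumulative hierarchy, with extensional equality _≗_.
data 𝕍 : Set₁ where
  sup : (I : Set) → (I → 𝕍) → 𝕍

index : 𝕍 → Set
index (sup I _) = I

elem : (x : 𝕍) → index x → 𝕍
elem (sup _ a) = a

infix 4 _≗_ _∈ⱽ_

_≗_ : 𝕍 → 𝕍 → Set
sup I a ≗ sup J b = (∀ i → ∃[ j ] a i ≗ b j) × (∀ j → ∃[ i ] a i ≗ b j)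

_∈ⱽ_ : 𝕍 → 𝕍 → Set
x ∈ⱽ y = ∃[ j ] x ≗ elem y j

∅ⱽ : 𝕍
∅ⱽ = sup ⊥ λ ()

｛_,_｝ⱽ : 𝕍 → 𝕍 → 𝕍
｛ x , y ｝ⱽ = sup Bool (if_then x else y)

⟨_,_⟩ⱽ : 𝕍 → 𝕍 → 𝕍
⟨ x , y ⟩ⱽ = ｛ ｛ x , x ｝ⱽ , ｛ x , y ｝ⱽ ｝ⱽ

⋃ⱽ : (I : Set) → (I → 𝕍) → 𝕍
⋃ⱽ I a = sup (Σ[ i ∈ I ] index (a i)) λ (i , j) → elem (a i) j

sucⱽ : 𝕍 → 𝕍
sucⱽ x = sup (Maybe (index x)) λ { nothing → x ; (just i) → elem x i }

ordⱽ : Ord → 𝕍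
ordⱽ zero    = ∅ⱽ
ordⱽ (suc α) = sucⱽ (ordⱽ α)
ordⱽ (lim f) = ⋃ⱽ ℕ (λ i → ordⱽ (f i))

natⱽ : ℕ → 𝕍
natⱽ n = ordⱽ (fromℕ n)

-- The transitive closure of {x}, not of x.
TC : 𝕍 → 𝕍
TC (sup I a) = sup (Maybe (Σ[ i ∈ I ] index (TC (a i))))
  λ { nothing → sup I a ; (just (i , j)) → elem (TC (a i)) j }

codeT  : ∀ {n} → Term τ n → 𝕍
codeTs : ∀ {n k} → Vec (Term τ n) k → 𝕍
codeT     (var i)    = ⟨ natⱽ 0 , natⱽ (Data.Fin.toℕ i) ⟩ⱽ
codeT {τ} (app g ts) =
  ⟨ natⱽ 1 , ⟨ natⱽ (Injection.to (funCode τ) g) , codeTs ts ⟩ⱽ ⟩ⱽ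
codeTs []       = ∅ⱽ
codeTs (t ∷ ts) = ⟨ codeT t , codeTs ts ⟩ⱽ

code : ∀ {n} → Fm τ n → 𝕍
code     ⊥'         = ⟨ natⱽ 0 , ∅ⱽ ⟩ⱽ
code     (s ≐' t)   = ⟨ natⱽ 1 , ⟨ codeT s , codeT t ⟩ⱽ ⟩ⱽ
code {τ} (rel' R ts) =
  ⟨ natⱽ 2 , ⟨ natⱽ (Injection.to (relCode τ) R) , codeTs ts ⟩ⱽ ⟩ⱽ
code     (¬' F)     = ⟨ natⱽ 3 , code F ⟩ⱽ
code     (F ∧' G)   = ⟨ natⱽ 4 , ⟨ code F , code G ⟩ⱽ ⟩ⱽ
code     (⋁ f)      = ⟨ natⱽ 5 , sup ℕ (λ i → code (f i)) ⟩ⱽ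
code     (∃' F)     = ⟨ natⱽ 6 , code F ⟩ⱽ

codeTheory : Theory τ → 𝕍
codeTheory {τ} S = sup (Σ (Sentence τ) S) (λ F → code (proj₁ F))

data STFm (n : ℕ) : Set where
  _∈'_ _='_ : Fin n → Fin n → STFm n
  ¬'_       : STFm n → STFm n
  _∧'_      : STFm n → STFm n → STFm n
  ∃'_       : STFm (suc n) → STFm n

module _ (A : 𝕍) where

  SatST : ∀ {n} → STFm n → Vec (index A) n → Set
  SatST (i ∈' j) a = elem A (lookup a i) ∈ⱽ elem A (lookup a j)
  SatST (i =' j) a = elem A (lookup a i) ≗ elem A (lookup a j)
  SatST (¬' ψ)   a = ¬ SatST ψ a
  SatST (ψ ∧' χ) a = SatST ψ a × SatST χ a
  SatST (∃' ψ)   a = ∃[ b ] SatST ψ (b ∷ a)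

data IsΔ₀ : ∀ {n} → Pred (STFm n) 0ℓ where
  _∈'_ : ∀ {n} (i j : Fin n) → IsΔ₀ (i ∈' j)
  _='_ : ∀ {n} (i j : Fin n) → IsΔ₀ (i =' j)
  ¬'_  : ∀ {n} {ψ : STFm n} → IsΔ₀ ψ → IsΔ₀ (¬' ψ)
  _∧'_ : ∀ {n} {ψ χ : STFm n} → IsΔ₀ ψ → IsΔ₀ χ → IsΔ₀ (ψ ∧' χ)
  bounded : ∀ {n} {ψ : STFm (suc n)} (i : Fin n) → IsΔ₀ ψ →
            IsΔ₀ (∃' ((zero ∈' suc i) ∧' ψ))

data IsΣ₁ : ∀ {n} → Pred (STFm n) 0ℓ where
  Δ₀  : ∀ {n} {ψ : STFm n} → IsΔ₀ ψ → IsΣ₁ ψ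
  ∃'_ : ∀ {n} {ψ : STFm (suc n)} → IsΣ₁ ψ → IsΣ₁ (∃' ψ)

-- The set of subsets of A first-order definable with parameters over
-- (A , ∈).
Def : 𝕍 → 𝕍
Def A = sup (Σ[ k ∈ ℕ ] STFm (suc k) × Vec (index A) k)
  λ (k , ψ , a) → sup (Σ[ b ∈ index A ] SatST A ψ (b ∷ a)) (elem A ∘ proj₁)

L⟨_,_⟩ : Ord → 𝕍 → 𝕍
L⟨ zero  , t ⟩ = TC t
L⟨ suc α , t ⟩ = Def L⟨ α , t ⟩
L⟨ lim f , t ⟩ = ⋃ⱽ ℕ (λ i → L⟨ f i , t ⟩)

L⟨ω₁,_⟩ : 𝕍 → 𝕍
L⟨ω₁, t ⟩ = ⋃ⱽ Ord (λ α → L⟨ α , t ⟩)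

-- A ⊨ KP, for A transitive: pairing, union, Δ₀-separation,
-- Δ₀-collection (foundation holds in every transitive set).
record IsAdmissible (A : 𝕍) : Set where
  private
    _ε_ : index A → index A → Set
    x ε y = elem A x ∈ⱽ elem A y
  field
    inhabited  : index A
    transitive : ∀ x j → elem (elem A x) j ∈ⱽ A
    pairing    : ∀ x y → ∃[ z ] x ε z × y ε z
    union      : ∀ x → ∃[ z ] (∀ y w → y ε x → w ε y → w ε z)
    separation : ∀ {n} (ψ : STFm (suc n)) → IsΔ₀ ψ → (a : Vec (index A) n) →
                 ∀ x → ∃[ z ] (∀ w → w ε z ⇔ (w ε x × SatST A ψ (w ∷ a)))
    collection : ∀ {n} (ψ : STFm (2 + n)) → IsΔ₀ ψ → (a : Vec (index A) n) →
                 ∀ x → (∀ w → w ε x → ∃[ y ] SatST A ψ (y ∷ w ∷ a)) →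
                 ∃[ z ] (∀ w → w ε x → ∃[ y ] y ε z × SatST A ψ (y ∷ w ∷ a))

IsΔ₁Over : (A : 𝕍) → (index A → index A → Set) → Set
IsΔ₁Over A R =
  Σ[ k ∈ ℕ ] Σ[ a ∈ Vec (index A) k ]
  Σ[ ψ ∈ STFm (2 + k) ] Σ[ χ ∈ STFm (2 + k) ] IsΣ₁ ψ × IsΣ₁ χ
  × (∀ x y → (R x y ⇔ SatST A ψ (x ∷ y ∷ a)) × ((¬ R x y) ⇔ SatST A χ (x ∷ y ∷ a)))

record SacksData (τ : Vocabulary) (φ : Sentence τ) : Set₁ where
  field
    Lang : Ord → Language τ
    Thy  : Ord → Theory τ
    A    : Ord → Structure τ
    C  : Pred Ord 0ℓ
    B    : Ord → Structure τ

  T-set : 𝕍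
  T-set = codeTheory (T₀ φ)

  field
    branch : IsBranch φ Lang Thy
    Thy∈L  : ∀ δ → codeTheory (Thy δ) ∈ⱽ L⟨ω₁, T-set ⟩
    Thy-Δ₁ : IsΔ₁Over L⟨ω₁, T-set ⟩ λ x y →
               ∃[ δ ] elem L⟨ω₁, T-set ⟩ x ≗ ordⱽ δ
                    × elem L⟨ω₁, T-set ⟩ y ≗ codeTheory (Thy δ)

    A-atomic : ∀ δ → IsAtomicModel (A δ) (Lang δ) (Thy δ)
    A-rank   : ∀ δ → IsSacksRank (A δ) δ
    A-type   : ∀ δ → ∃[ n ] Σ[ a ∈ Vec (Elem (A (suc δ))) n ]
               IsType (Lang δ) (Thy δ) (tp (Lang δ) (A (suc δ)) a)
               × ¬ IsPrincipal (Thy δ) (tp (Lang δ) (A (suc δ)) a)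

    club       : IsClub C
    >ω         : ∀ {κ} → C κ → ω < κ
    admissible : ∀ {κ} → C κ → IsAdmissible L⟨ κ , T-set ⟩
    B-model    : ∀ {κ} → C κ → B κ ⊨ᵀ Thy κ
    B-types    : ∀ {κ} → C κ → ∀ {n} (p : Pred (Fm τ n) 0ℓ) →
                 IsType (Lang κ) (Thy κ) p → ¬ IsPrincipal (Thy κ) p →
                 Σ[ b ∈ Vec (Elem (B κ)) n ] (∀ F → p F → Sat (B κ) F b)
    B-ω₁       : ∀ {κ} → C κ → Isω₁Of (B κ) κ
    B-rank     : ∀ {κ} → C κ → IsSacksRank (B κ) (suc κ)

open SacksData public

S° : {φ : Sentence τ} → SacksData τ φ → Pred Ord 0ℓ
S° {φ = φ} D κ = 𝔉 φ κ × C D κ × (∃[ β ] IsQR φ β × β < κ)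

IsFiberModel : {φ : Sentence τ} → SacksData τ φ → Ord → Pred (Structure τ) 0ℓ
IsFiberModel D κ M = (M ⊨ᵀ Thy D κ) × Isω₁Of M κ

{-# OPTIONS --safe #-}

-- Two models of T_α whose tuples a, b have the same L_α-type satisfy the
-- same Πin α and Σin α formulas at a, b.  Indeed, for β < α a tuple c can be
-- matched by some d so that (c,a) and (d,b) have the same L_β-type p: if θ
-- generates p, use ∃x θ; otherwise ⋀ p belongs to L_{β+1}, and ∃x ⋀ p does.
-- In particular all models of T_κ are ≡_κ.  If a model M of T_κ had cSR
-- below κ, its Scott sentence would pass to A_κ and B_κ, so A_κ ≅ M ≅ B_κ.
-- But B_κ realizes the non-principal type of T_κ realized in A_{κ+1}, and
-- the atomic model A_κ does not.
module Submission where

open import Defs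
open import Axiom.ExcludedMiddle using (ExcludedMiddle)
open import Data.Bool using (T)
open import Data.Empty using (⊥; ⊥-elim)
open import Data.Fin using (Fin; zero; suc)
open import Data.List using (List; []; _∷_)
open import Data.List.Relation.Unary.All using (All; []; _∷_)
import Data.List.Relation.Unary.All as All
open import Data.List.Relation.Unary.All.Properties using (map⁺)
open import Data.List.Relation.Unary.Any using (here; there)
open import Data.Nat using (ℕ; zero; suc; _+_)
open import Data.Product using (Σ-syntax; ∃-syntax; _×_; _,_; proj₁; proj₂)
open import Data.Sum using (_⊎_; inj₁; inj₂)
import Data.Sum as Sum
open import Data.Vec using (Vec; []; _∷_; _++_; lookup; map)
open import Data.Vec.Properties using (map-id; map-∘; map-cong; lookup-map)
open import Function.Bundles using (_⇔_; mk⇔; Equivalence; module Inverse)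
open import Function.Construct.Identity using (↔-id)
open import Level using (0ℓ)
open import Relation.Binary.PropositionalEquality
  using (_≡_; refl; sym; trans; cong; cong₂; subst₂) renaming (subst to transport)
open import Relation.Nullary using (¬_; Dec; yes; no)
open import Relation.Nullary.Decidable using (decidable-stable)
open import Relation.Unary using (Pred; _⊆_; _≐_)

open Equivalence using (to; from)

private
  variable
    n m k : ℕ
    α β γ : Ord
    F G : Fm τ n

-- The order on Brouwer trees.

≤-trans : α ≤ β → β ≤ γ → α ≤ γ
<-≤-trans : α < β → β ≤ γ → α < γ
≤-<-trans : α ≤ β → β < γ → α < γ
≤-trans zero≤      _ = zero≤
≤-trans (suc≤ p)   q = suc≤ (<-≤-trans p q)
≤-trans (lim≤ p)   q = lim≤ (λ i → ≤-trans (p i) q)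
<-≤-trans (<suc p)   (suc≤ q) = ≤-<-trans p q
<-≤-trans (<lim i p) (lim≤ q) = <-≤-trans p (q i)
≤-<-trans p (<suc q)   = <suc (≤-trans p q)
≤-<-trans p (<lim i q) = <lim i (≤-<-trans p q)

<⇒≤      : α < β → α ≤ β
≤-step   : α ≤ β → α ≤ suc β
≤-lim-step : ∀ {f} i → α ≤ f i → α ≤ lim f
<⇒≤ (<suc p)   = ≤-step p
<⇒≤ (<lim i p) = ≤-lim-step i (<⇒≤ p)
≤-step zero≤    = zero≤
≤-step (suc≤ p) = suc≤ (<suc (<⇒≤ p))
≤-step (lim≤ p) = lim≤ (λ i → ≤-step (p i))
≤-lim-step i zero≤    = zero≤
≤-lim-step i (suc≤ p) = suc≤ (<lim i p)
≤-lim-step i (lim≤ p) = lim≤ (λ j → ≤-lim-step i (p j))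

≤-refl : ∀ α → α ≤ α
≤-refl zero    = zero≤
≤-refl (suc α) = suc≤ (<suc (≤-refl α))
≤-refl (lim f) = lim≤ (λ i → ≤-lim-step i (≤-refl (f i)))

≤-lim : ∀ f i → f i ≤ lim f
≤-lim f i = ≤-lim-step i (≤-refl (f i))

-- False for γ in place of suc γ: Πin zero contains the quantifier-free
-- formulas, which are not of the form ⋀ f.
Πin-raise : suc γ ≤ α → Πin (suc γ) F → Πin α F
Πin-raise _ (qf (suc≤ ()) _)
Πin-raise p (conj h) = conj λ i →
  let (β , β<γ+1 , rest) = h i in β , <-≤-trans β<γ+1 p , rest

-- Satisfaction under `_≈_`, substitution and quantifier blocks.

≈-refl : (F : Fm τ n) → F ≈ F
≈-refl ⊥'          = ⊥≈
≈-refl (s ≐' t)    = ≐≈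
≈-refl (rel' R ts) = rel≈
≈-refl (¬' F)      = ¬≈ (≈-refl F)
≈-refl (F ∧' G)    = ∧≈ (≈-refl F) (≈-refl G)
≈-refl (⋁ f)       = ⋁≈ (λ i → i , ≈-refl (f i)) (λ i → i , ≈-refl (f i))
≈-refl (∃' F)      = ∃≈ (≈-refl F)

≈-sym : {F G : Fm τ n} → F ≈ G → G ≈ F
≈-sym ⊥≈       = ⊥≈
≈-sym ≐≈       = ≐≈
≈-sym rel≈     = rel≈
≈-sym (¬≈ p)   = ¬≈ (≈-sym p)
≈-sym (∧≈ p q) = ∧≈ (≈-sym p) (≈-sym q)
≈-sym (⋁≈ p q) = ⋁≈ (λ j → let (i , r) = q j in i , ≈-sym r)
                    (λ i → let (j , r) = p i in j , ≈-sym r)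
≈-sym (∃≈ p)   = ∃≈ (≈-sym p)

module _ (M : Structure τ) where

  Sat-≈ : {F G : Fm τ n} → F ≈ G → ∀ a → Sat M F a ⇔ Sat M G a
  Sat-≈ ⊥≈       a = mk⇔ (λ x → x) (λ x → x)
  Sat-≈ ≐≈       a = mk⇔ (λ x → x) (λ x → x)
  Sat-≈ rel≈     a = mk⇔ (λ x → x) (λ x → x)
  Sat-≈ (¬≈ p)   a = mk⇔ (λ ¬f g → ¬f (from (Sat-≈ p a) g))
                         (λ ¬g f → ¬g (to (Sat-≈ p a) f))
  Sat-≈ (∧≈ p q) a = mk⇔ (λ (f , g) → to (Sat-≈ p a) f , to (Sat-≈ q a) g)
                         (λ (f , g) → from (Sat-≈ p a) f , from (Sat-≈ q a) g)
  Sat-≈ (⋁≈ p q) a = mk⇔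
    (λ (i , s) → let (j , r) = p i in j , to (Sat-≈ r a) s)
    (λ (j , s) → let (i , r) = q j in i , from (Sat-≈ r a) s)
  Sat-≈ (∃≈ p)   a = mk⇔ (λ (b , s) → b , to (Sat-≈ p (b ∷ a)) s)
                         (λ (b , s) → b , from (Sat-≈ p (b ∷ a)) s)

  module _ {σ : Subst τ n m} {a : Vec (Elem M) m} {a′ : Vec (Elem M) n}
           (agree : ∀ i → lookup a′ i ≡ evalT M a (σ i)) where

    evalT-subst  : ∀ t → evalT M a (substT σ t) ≡ evalT M a′ t
    evalTs-subst : (ts : Vec (Term τ n) k) →
                   evalTs M a (substTs σ ts) ≡ evalTs M a′ ts
    evalT-subst (var i)    = sym (agree i)
    evalT-subst (app g ts) = cong (fun M g) (evalTs-subst ts)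
    evalTs-subst []       = refl
    evalTs-subst (t ∷ ts) = cong₂ _∷_ (evalT-subst t) (evalTs-subst ts)

  agree-lift : {σ : Subst τ n m} {a : Vec (Elem M) m} {a′ : Vec (Elem M) n} →
               (∀ i → lookup a′ i ≡ evalT M a (σ i)) → ∀ b i →
               lookup (b ∷ a′) i ≡ evalT M (b ∷ a) (lift σ i)
  agree-lift         agree b zero    = refl
  agree-lift {σ = σ} agree b (suc i) =
    trans (agree i) (sym (evalT-subst (λ _ → refl) (σ i)))

  -- Pointwise agreement, rather than one fixed vector of values, lets weakening, instantiation and
  -- lifted sentences choose their own `a′`, with agreement by `refl` or vacuous.
  Sat-subst : {σ : Subst τ n m} {a : Vec (Elem M) m} {a′ : Vec (Elem M) n} →
              (∀ i → lookup a′ i ≡ evalT M a (σ i)) → ∀ F →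
              Sat M (subst σ F) a ⇔ Sat M F a′
  Sat-subst e ⊥'          = mk⇔ (λ x → x) (λ x → x)
  Sat-subst e (s ≐' t)    = mk⇔
    (subst₂ _≡_ (evalT-subst e s) (evalT-subst e t))
    (subst₂ _≡_ (sym (evalT-subst e s)) (sym (evalT-subst e t)))
  Sat-subst e (rel' R ts) = mk⇔
    (transport (λ v → T (rel M R v)) (evalTs-subst e ts))
    (transport (λ v → T (rel M R v)) (sym (evalTs-subst e ts)))
  Sat-subst e (¬' F)      = mk⇔ (λ ¬f f → ¬f (from (Sat-subst e F) f))
                                (λ ¬f f → ¬f (to (Sat-subst e F) f))
  Sat-subst e (F ∧' G)    = mk⇔
    (λ (f , g) → to (Sat-subst e F) f , to (Sat-subst e G) g)
    (λ (f , g) → from (Sat-subst e F) f , from (Sat-subst e G) g)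
  Sat-subst e (⋁ f)       = mk⇔ (λ (i , s) → i , to (Sat-subst e (f i)) s)
                                (λ (i , s) → i , from (Sat-subst e (f i)) s)
  Sat-subst e (∃' F)      = mk⇔
    (λ (b , s) → b , to (Sat-subst (agree-lift e b) F) s)
    (λ (b , s) → b , from (Sat-subst (agree-lift e b) F) s)

  Sat-wk : ∀ (F : Fm τ n) b {a} → Sat M (wk F) (b ∷ a) ⇔ Sat M F a
  Sat-wk F b = Sat-subst (λ _ → refl) F

  Sat-[] : ∀ (F : Fm τ (suc n)) t {a} →
           Sat M (F [ t ]) a ⇔ Sat M F (evalT M a t ∷ a)
  Sat-[] F t = Sat-subst (λ { zero → refl ; (suc i) → refl }) F

  Sat-∃* : ∀ k {F : Fm τ (k + n)} {a} →
           Sat M (∃* k F) a ⇔ (Σ[ c ∈ Vec (Elem M) k ] Sat M F (c ++ a))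
  Sat-∃* zero    = mk⇔ ([] ,_) λ { ([] , s) → s }
  Sat-∃* (suc k) {F} = mk⇔
    -- `∃*` adds each quantifier innermost, so the witness `b` for variable zero comes last and
    -- heads the tuple.
    (λ s → let (c , b , s′) = to (Sat-∃* k {∃' F}) s in b ∷ c , s′)
    (λ { (b ∷ c , s) → from (Sat-∃* k {∃' F}) (c , b , s) })

  ⊨ᵀ-↑ : {S : Theory τ} → M ⊨ᵀ S → (a : Vec (Elem M) n) → ∀ F → (S ↑ n) F → Sat M F a
  ⊨ᵀ-↑ M⊨S a _ (G , SG , F≡) =
    transport (λ H → Sat M H a) (sym F≡) (from (Sat-subst (λ ()) G) (M⊨S G SG))

-- Invariance of satisfaction under isomorphism.

≅-refl : (M : Structure τ) → M ≅ M
≅-refl M = record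
  { bijection = ↔-id _
  ; rel-pres  = λ R v → cong (rel M R) (sym (map-id v))
  ; fun-pres  = λ g v → cong (fun M g) (sym (map-id v))
  }

module Iso {M N : Structure τ} (M≅N : M ≅ N) where
  open _≅_ M≅N renaming (to to h)
  open Inverse bijection using (strictlyInverseˡ; strictlyInverseʳ) renaming (from to h⁻¹)

  h-evalT  : ∀ (a : Vec (Elem M) n) t → h (evalT M a t) ≡ evalT N (map h a) t
  h-evalTs : ∀ (a : Vec (Elem M) n) (ts : Vec (Term τ n) k) →
             map h (evalTs M a ts) ≡ evalTs N (map h a) ts
  h-evalT a (var i)    = sym (lookup-map i h a)
  h-evalT a (app g ts) =
    trans (fun-pres g (evalTs M a ts)) (cong (fun N g) (h-evalTs a ts))
  h-evalTs a []       = refl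
  h-evalTs a (t ∷ ts) = cong₂ _∷_ (h-evalT a t) (h-evalTs a ts)

  h-injective : ∀ {x y} → h x ≡ h y → x ≡ y
  h-injective {x} {y} e =
    trans (sym (strictlyInverseʳ x)) (trans (cong h⁻¹ e) (strictlyInverseʳ y))

  rel-evalTs : ∀ R (a : Vec (Elem M) n) ts →
               rel M R (evalTs M a ts) ≡ rel N R (evalTs N (map h a) ts)
  rel-evalTs R a ts =
    trans (rel-pres R (evalTs M a ts)) (cong (rel N R) (h-evalTs a ts))

  Sat-≅ : ∀ F (a : Vec (Elem M) n) → Sat M F a ⇔ Sat N F (map h a)
  Sat-≅ ⊥'          a = mk⇔ (λ x → x) (λ x → x)
  Sat-≅ (s ≐' t)    a = mk⇔
    (λ e → trans (sym (h-evalT a s)) (trans (cong h e) (h-evalT a t)))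
    (λ e → h-injective (trans (h-evalT a s) (trans e (sym (h-evalT a t)))))
  Sat-≅ (rel' R ts) a = mk⇔
    (transport T (rel-evalTs R a ts)) (transport T (sym (rel-evalTs R a ts)))
  Sat-≅ (¬' F)      a = mk⇔ (λ ¬f f → ¬f (from (Sat-≅ F a) f))
                            (λ ¬f f → ¬f (to (Sat-≅ F a) f))
  Sat-≅ (F ∧' G)    a = mk⇔ (λ (f , g) → to (Sat-≅ F a) f , to (Sat-≅ G a) g)
                            (λ (f , g) → from (Sat-≅ F a) f , from (Sat-≅ G a) g)
  Sat-≅ (⋁ f)       a = mk⇔ (λ (i , s) → i , to (Sat-≅ (f i) a) s)
                            (λ (i , s) → i , from (Sat-≅ (f i) a) s)
  Sat-≅ (∃' F)      a = mk⇔
    (λ (b , s) → h b , to (Sat-≅ F (b ∷ a)) s)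
    -- Surjectivity: the witness `c` is replaced by `h (h⁻¹ c)`, the image of an element of `M`.
    (λ (c , s) → h⁻¹ c , from (Sat-≅ F (h⁻¹ c ∷ a))
      (transport (λ x → Sat N F (x ∷ map h a)) (sym (strictlyInverseˡ c)) s))

  map-h-h⁻¹ : (c : Vec (Elem N) n) → map h (map h⁻¹ c) ≡ c
  map-h-h⁻¹ c = trans (sym (map-∘ h h⁻¹ c)) (trans (map-cong strictlyInverseˡ c) (map-id c))

  Sat-≅⁻¹ : ∀ F (c : Vec (Elem N) n) → Sat N F c → Sat M F (map h⁻¹ c)
  Sat-≅⁻¹ F c s = from (Sat-≅ F _) (transport (Sat N F) (sym (map-h-h⁻¹ c)) s)

-- Derivability, types and closed languages.

⊩-mono : {P Q : Pred (Fm τ n) 0ℓ} → P ⊆ Q → P ⊩ F → Q ⊩ F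
⊩-mono P⊆Q (Γ , PΓ , Γ⊢F) = Γ , All.map P⊆Q PΓ , Γ⊢F

module _ {S : Theory τ} {p q : Pred (Fm τ n) 0ℓ} (p≐q : p ≐ q) where
  private
    p⊆q : p ⊆ q
    p⊆q = proj₁ p≐q
    q⊆p : q ⊆ p
    q⊆p = proj₂ p≐q

  -- One type arises as `tp L M a`, as `range f` for an enumeration `f`, or from tuples of different
  -- structures; these predicates agree only extensionally.
  IsPrincipal-resp-≐ : IsPrincipal S p → IsPrincipal S q
  IsPrincipal-resp-≐ (θ , pθ , gen) = θ , p⊆q pθ , λ ψ qψ → gen ψ (q⊆p qψ)

  IsType-resp-≐ : {L : Language τ} → IsType L S p → IsType L S q
  IsType-resp-≐ P = record
    { inL        = λ qF → inL (q⊆p qF)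
    ; consistent = λ c → consistent (⊩-mono (λ { (inj₁ s) → inj₁ s
                                               ; (inj₂ x) → inj₂ (q⊆p x) }) c)
    ; ω-prop     = λ f q⋁ → let (i , pf) = ω-prop f (q⊆p q⋁) in i , p⊆q pf
    ; maximal    = λ F LF con → p⊆q (maximal F LF λ c →
        con (⊩-mono (λ { (inj₁ s) → inj₁ s
                       ; (inj₂ (inj₁ x)) → inj₂ (inj₁ (p⊆q x))
                       ; (inj₂ (inj₂ e)) → inj₂ (inj₂ e) }) c))
    }
    where open IsType P

IsClosed : Language τ → Set
IsClosed L = ∀ n → Closure L n ⊆ L n

∃*-closed : {L : Language τ} → IsClosed L → ∀ k {F : Fm τ (k + n)} →
            L (k + n) F → L n (∃* k F)
∃*-closed cl zero    LF = LF
∃*-closed cl (suc k) LF = ∃*-closed cl k (cl _ (∃' (base LF)))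

QuantifierFree⇒Closure : {L : Language τ} {F : Fm τ n} → QuantifierFree F → Closure L n F
QuantifierFree⇒Closure ⊥'          = ⊥'
QuantifierFree⇒Closure (s ≐' t)    = s ≐' t
QuantifierFree⇒Closure (rel' R ts) = rel' R ts
QuantifierFree⇒Closure (¬' p)      = ¬' QuantifierFree⇒Closure p
QuantifierFree⇒Closure (p ∧' q)    = QuantifierFree⇒Closure p ∧' QuantifierFree⇒Closure q

-- One direction is enough: for a language closed under negation the relation is classically
-- symmetric.
SatisfiesType : Language τ → (M N : Structure τ) → Vec (Elem M) n → Vec (Elem N) n → Set
SatisfiesType L M N a b = ∀ F → L _ F → Sat M F a → Sat N F b

-- Classical facts: comparison of ordinals, and soundness.

module Classical (em : ExcludedMiddle 0ℓ) where

  dne : {P : Set} → ¬ ¬ P → P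
  dne = decidable-stable em

  ≤-<-connex : ∀ α β → α ≤ β ⊎ β < α
  ≤-<-connex zero    β = inj₁ zero≤
  -- `suc α ≤ β` amounts to `α < β`, so this is the question for the swapped pair.
  ≤-<-connex (suc α) β with ≤-<-connex β α
  ... | inj₁ β≤α = inj₂ (<suc β≤α)
  ... | inj₂ α<β = inj₁ (suc≤ α<β)
  ≤-<-connex (lim f) β with em {P = ∃[ i ] β < f i}
  ... | yes (i , β<fᵢ) = inj₂ (<lim i β<fᵢ)
  ... | no none = inj₁ (lim≤ λ i →
    Sum.fromInj₁ (λ β<fᵢ → ⊥-elim (none (i , β<fᵢ))) (≤-<-connex (f i) β))

  -- Either some term already reaches the supremum, or all terms lie strictly below it, and then
  -- `β < f i` gives `suc β ≤ f i < lim f`.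
  lim-attained⊎IsLimit : ∀ f → (∃[ i ] lim f ≤ f i) ⊎ IsLimit (lim f)
  lim-attained⊎IsLimit f with em {P = ∃[ i ] lim f ≤ f i}
  ... | yes attained = inj₁ attained
  ... | no ¬attained = inj₂
    ( ≤-<-trans zero≤ (below 0)
    , λ { (<lim i β<fᵢ) → ≤-<-trans (suc≤ β<fᵢ) (below i) } )
    where
    below : ∀ i → f i < lim f
    below i with ≤-<-connex (lim f) (f i)
    ... | inj₁ p = ⊥-elim (¬attained (i , p))
    ... | inj₂ p = p

  Sat-⋀ : ∀ (M : Structure τ) (f : ℕ → Fm τ n) {a} →
          Sat M (⋀ f) a ⇔ (∀ i → Sat M (f i) a)
  Sat-⋀ M f = mk⇔ (λ s i → dne (λ ¬f → s (i , ¬f))) (λ s (i , ¬f) → ¬f (s i))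

  Sat-∀* : ∀ (M : Structure τ) k {F : Fm τ (k + n)} {a} →
           Sat M (∀* k F) a ⇔ ((c : Vec (Elem M) k) → Sat M F (c ++ a))
  Sat-∀* M zero    = mk⇔ (λ { s [] → s }) (λ s → s [])
  Sat-∀* M (suc k) {F} = mk⇔
    (λ { s (b ∷ c) → dne (λ ¬f → to (Sat-∀* M k {∀' F}) s c (b , ¬f)) })
    (λ s → from (Sat-∀* M k {∀' F}) λ c (b , ¬f) → ¬f (s (b ∷ c)))

  -- The link from derivations to models: it makes realized types consistent, and lets a formula
  -- generating a type force that type in every model of the theory.
  soundness : (M : Structure τ) {Γ : List (Fm τ n)} {F : Fm τ n} → Γ ⊢ F →
              ∀ a → All (λ G → Sat M G a) Γ → Sat M F a
  soundness M (hyp F∈Γ)     a γ = All.lookup γ F∈Γ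
  soundness M (conv F≈G d)  a γ = to (Sat-≈ M F≈G a) (soundness M d a γ)
  soundness M (¬I d)        a γ = λ f → soundness M d a (f ∷ γ)
  soundness M (¬E d e)      a γ = soundness M d a γ (soundness M e a γ)
  soundness M (raa d)       a γ = dne λ ¬f → soundness M d a (¬f ∷ γ)
  soundness M (∧I d e)      a γ = soundness M d a γ , soundness M e a γ
  soundness M (∧E₁ d)       a γ = proj₁ (soundness M d a γ)
  soundness M (∧E₂ d)       a γ = proj₂ (soundness M d a γ)
  soundness M (⋁I i d)      a γ = i , soundness M d a γ
  soundness M (∃I {F = F} t d) a γ =
    evalT M a t , to (Sat-[] M F t) (soundness M d a γ)
  soundness M (∃E {G = G} d e) a γ =
    let (b , f) = soundness M d a γ
    in to (Sat-wk M G b) (soundness M e (b ∷ a)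
         (f ∷ map⁺ (All.map (λ {H} → from (Sat-wk M H b)) γ)))
  soundness M ≐-refl        a γ = refl
  soundness M (≐-subst {s = s} {t = t} F d e) a γ =
    from (Sat-[] M F t) (transport (λ x → Sat M F (x ∷ a)) (soundness M d a γ)
      (to (Sat-[] M F s) (soundness M e a γ)))
  soundness M nonempty      a γ = point M , refl

  ⊩-sound : (M : Structure τ) {P : Pred (Fm τ n) 0ℓ} {F : Fm τ n} → P ⊩ F →
            ∀ a → (∀ G → P G → Sat M G a) → Sat M F a
  ⊩-sound M (Γ , PΓ , d) a s = soundness M d a (All.map (λ {G} → s G) PΓ)

  -- Realized types and the extension of tuples.

  module _ {L : Language τ} (closed : IsClosed L) where

    SatisfiesType-sym : {M N : Structure τ} {a : Vec (Elem M) n} {b : Vec (Elem N) n} →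
                        SatisfiesType L M N a b → SatisfiesType L N M b a
    SatisfiesType-sym same F LF s =
      dne λ ¬s → same (¬' F) (closed _ (¬' base LF)) ¬s s

    module _ (M : Structure τ) (a : Vec (Elem M) n) where

      tp-resp-≈ : F ≈ G → tp L M a F → tp L M a G
      tp-resp-≈ F≈G (LF , s) = closed _ (conv F≈G (base LF)) , to (Sat-≈ M F≈G a) s

      tp-isType : {S : Theory τ} → M ⊨ᵀ S → IsType L S (tp L M a)
      tp-isType M⊨S = record
        { inL        = proj₁
        ; consistent = λ c → ⊩-sound M c a λ { F (inj₁ SF) → ⊨ᵀ-↑ M M⊨S a F SF
                                             ; F (inj₂ (_ , s)) → s }
        ; ω-prop     = λ { f (L⋁ , i , s) → i , closed _ (sub-⋁ i (base L⋁)) , s }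
        -- If `F` failed at `a`, the type would contain `¬' F`, and adding `F` would be
        -- inconsistent.
        ; maximal    = λ F LF con → LF , dne λ ¬s → con
            ( ¬' F ∷ F ∷ []
            , inj₂ (inj₁ (closed _ (¬' base LF) , ¬s)) ∷ inj₂ (inj₂ refl) ∷ []
            , ¬E (hyp (here refl)) (hyp (there (here refl))) )
        }

      private
        -- Filters an enumeration of `L` while keeping it total: the default `¬' ⊥'` lies in every
        -- realized type.
        keep : ∀ F → Dec (tp L M a F) → Fm τ n
        keep F (yes _) = F
        keep F (no _)  = ¬' ⊥'

        keep-tp : ∀ F d → tp L M a (keep F d)
        keep-tp F (yes t) = t
        keep-tp F (no _)  = closed _ (¬' ⊥') , λ ()

        keep-≡ : ∀ F d → tp L M a F → F ≡ keep F d
        keep-≡ F (yes _) t = refl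
        keep-≡ F (no ¬t) t = ⊥-elim (¬t t)

      tp-enumeration : Σ[ e ∈ (ℕ → Fm τ n) ] (∀ F → L n F → ∃[ i ] F ≈ e i) →
                       ∃[ f ] range f ≐ tp L M a
      tp-enumeration (e , covers) =
          (λ i → keep (e i) em)
        , (λ (i , F≈) → tp-resp-≈ (≈-sym F≈) (keep-tp (e i) em))
        , λ {F} (LF , s) →
            let (i , F≈eᵢ) = covers F LF
            -- Since `e i` lies in the type, `keep` leaves it in place.
            in i , transport (F ≈_) (keep-≡ (e i) em (tp-resp-≈ F≈eᵢ (LF , s))) F≈eᵢ

  -- The forth step costs one level: agreement for the child's language `L⁺` yields agreement for
  -- `L`. `M ⊨ᵀ S` makes the type of `c ++ a` a type of `S`; `N ⊨ᵀ S` lets a generator force that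
  -- type in `N`.
  extend-tuple :
    {L L⁺ : Language τ} {S S⁺ : Theory τ} → IsFragment L → IsClosed L⁺ →
    IsChildNode L S L⁺ S⁺ → {M N : Structure τ} → M ⊨ᵀ S → N ⊨ᵀ S →
    {a : Vec (Elem M) n} {b : Vec (Elem N) n} → SatisfiesType L⁺ M N a b →
    (c : Vec (Elem M) k) → ∃[ d ] SatisfiesType L M N (c ++ a) (d ++ b)
  extend-tuple {k = k} {L} {L⁺} {S} frag cl⁺ node {M} {N} M⊨S N⊨S {a} {b} same c =
    helper em
    where
    open IsFragment frag
    open IsChildNode node using (language)

    p = tp L M (c ++ a)

    transfer : ∀ F → L⁺ _ F → Sat M F (c ++ a) → ∃[ d ] Sat N F (d ++ b)
    transfer F L⁺F s =
      to (Sat-∃* N k) (same _ (∃*-closed cl⁺ k L⁺F) (from (Sat-∃* M k) (c , s)))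

    helper : Dec (IsPrincipal S p) → ∃[ d ] SatisfiesType L M N (c ++ a) (d ++ b)
    helper (yes (θ , (Lθ , sθ) , generates)) =
      let (d , t) = transfer θ (proj₂ (language _) (base (inj₁ Lθ))) sθ
      in d , λ F LF s → ⊩-sound N (generates F (LF , s)) (d ++ b)
               λ { G (inj₁ SG) → ⊨ᵀ-↑ N N⊨S (d ++ b) G SG ; G (inj₂ refl) → t }
    helper (no nonprincipal) =
      let (f , f⊆p , p⊆f) = tp-enumeration closed M (c ++ a) (countable _)
          -- `Nonprincipal` speaks of `range f`, so typehood and non-principality are carried over
          -- from `p`.
          ⋀∈L⁺ = proj₂ (language _) (base (inj₂
            ( f , refl
            , IsType-resp-≐ (p⊆f , f⊆p) (tp-isType closed M (c ++ a) M⊨S)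
            , λ pr → nonprincipal (IsPrincipal-resp-≐ (f⊆p , p⊆f) pr) )))
          (d , t) = transfer (⋀ f) ⋀∈L⁺
            (from (Sat-⋀ M f) λ i → proj₂ (f⊆p (i , ≈-refl (f i))))
      in d , λ F LF s →
           let (i , F≈fᵢ) = p⊆f (LF , s)
           in from (Sat-≈ N F≈fᵢ (d ++ b)) (to (Sat-⋀ N f) t i)

  -- Preservation of `Σin` and `Πin` formulas along the branch.

  module Branch {φ : Sentence τ} {Lang : Ord → Language τ} {Thy : Ord → Theory τ}
                (branch : IsBranch φ Lang Thy) where
    open IsBranch branch

    Lang-closed : ∀ α → IsClosed (Lang α)
    Lang-closed α = IsFragment.closed (fragment α)

    Thy-below : {M : Structure τ} → β < α → M ⊨ᵀ Thy α → M ⊨ᵀ Thy β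
    Thy-below β<α M⊨ F SF =
      M⊨ F (mono-thy (suc≤ β<α) (IsChildNode.extends (child _) SF))

    -- For `β < α` the child of level `β` sits at `suc β ≤ α`, so successor and limit `α` are
    -- treated alike.
    extend-below : {M N : Structure τ} → M ⊨ᵀ Thy α → N ⊨ᵀ Thy α → β < α →
                   {a : Vec (Elem M) n} {b : Vec (Elem N) n} →
                   SatisfiesType (Lang α) M N a b → (c : Vec (Elem M) k) →
                   ∃[ d ] SatisfiesType (Lang β) M N (c ++ a) (d ++ b)
    extend-below {β = β} M⊨ N⊨ β<α same =
      extend-tuple (fragment β) (Lang-closed (suc β)) (child β)
        (Thy-below β<α M⊨) (Thy-below β<α N⊨)
        (λ F LF → same F (mono-lang (suc≤ β<α) _ LF))

    -- Mutual induction on membership in the hierarchy. An existential block is matched by extending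
    -- from `M` to `N`, a universal block by pulling a tuple of `N` back to `M`; each block drops to
    -- a level `β < α`, which pays for the extension.
    Σin-preserved : {M N : Structure τ} → M ⊨ᵀ Thy α → N ⊨ᵀ Thy α →
                    {a : Vec (Elem M) n} {b : Vec (Elem N) n} →
                    SatisfiesType (Lang α) M N a b →
                    {F : Fm τ n} → Σin α F → Sat M F a → Sat N F b
    Πin-preserved : {M N : Structure τ} → M ⊨ᵀ Thy α → N ⊨ᵀ Thy α →
                    {a : Vec (Elem M) n} {b : Vec (Elem N) n} →
                    SatisfiesType (Lang α) M N a b →
                    {F : Fm τ n} → Πin α F → Sat M F a → Sat N F b
    Σin-preserved M⊨ N⊨ same {F} (qf _ q) s =
      same F (Lang-closed _ _ (QuantifierFree⇒Closure q)) s
    Σin-preserved {M = M} {N} M⊨ N⊨ {a} {b} same (disj h) (i , s) with h i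
    ... | β , β<α , k , G , ΠG , f≡ =
      let (c , t) = to (Sat-∃* M k) (transport (λ H → Sat M H a) f≡ s)
          (d , same′) = extend-below M⊨ N⊨ β<α same c
      in i , transport (λ H → Sat N H b) (sym f≡) (from (Sat-∃* N k)
           (d , Πin-preserved (Thy-below β<α M⊨) (Thy-below β<α N⊨) same′ ΠG t))
    Πin-preserved M⊨ N⊨ same {F} (qf _ q) s =
      same F (Lang-closed _ _ (QuantifierFree⇒Closure q)) s
    Πin-preserved {α = α} {M = M} {N} M⊨ N⊨ {a} {b} same (conj {f = f} h) s =
      from (Sat-⋀ N f) conjunct
      where
      conjunct : ∀ i → Sat N (f i) b
      conjunct i with h i
      ... | β , β<α , k , G , ΣG , f≡ =
        transport (λ H → Sat N H b) (sym f≡) (from (Sat-∀* N k) λ d →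
          -- The counterpart of `d` is sought in `M`, so agreement is reversed before the extension
          -- and again after it.
          let (c , same′) = extend-below N⊨ M⊨ β<α
                              (SatisfiesType-sym (Lang-closed α) same) d
          in Σin-preserved (Thy-below β<α M⊨) (Thy-below β<α N⊨)
               (SatisfiesType-sym (Lang-closed β) same′) ΣG
               (to (Sat-∀* M k)
                 (transport (λ H → Sat M H a) f≡ (to (Sat-⋀ M f) s i)) c))

    -- Nodes give completeness at zero and successors. At `lim f`, the formula lies in the language
    -- of some `f i`: by monotonicity if the supremum is attained, by `limit-lang` at a true limit.
    Thy-complete : ∀ α F → Lang α 0 F → Thy α F ⊎ Thy α (¬' F)
    Thy-complete zero    = IsωCompleteIn.complete (IsRootNode.ω-complete root)
    Thy-complete (suc α) = IsωCompleteIn.complete (IsChildNode.ω-complete (child α))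
    Thy-complete (lim f) F LF with lim-attained⊎IsLimit f
    ... | inj₁ (i , lim≤fᵢ) =
      Sum.map (mono-thy fᵢ≤lim) (mono-thy fᵢ≤lim)
        (Thy-complete (f i) F (mono-lang lim≤fᵢ _ LF))
      where fᵢ≤lim = ≤-lim f i
    ... | inj₂ limit with proj₁ (limit-lang limit 0) LF
    -- `β` need not be a subtree of `lim f`, so the recursion goes through the `f i` above it.
    ... | β , <lim i β<fᵢ , LβF =
      Sum.map (mono-thy fᵢ≤lim) (mono-thy fᵢ≤lim)
        (Thy-complete (f i) F (mono-lang (<⇒≤ β<fᵢ) _ LβF))
      where fᵢ≤lim = ≤-lim f i

    -- Since `Thy α` decides every sentence of `Lang α`, the empty tuples of its models agree, which
    -- starts the preservation argument.
    ⊨ᵀ⇒≡ : {M N : Structure τ} → M ⊨ᵀ Thy α → N ⊨ᵀ Thy α → M ≡[ α ] N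
    ⊨ᵀ⇒≡ {α = α} {M} {N} M⊨ N⊨ F ΠF = mk⇔
      (Πin-preserved M⊨ N⊨ same ΠF)
      (Πin-preserved N⊨ M⊨ (SatisfiesType-sym (Lang-closed α) same) ΠF)
      where
      same : SatisfiesType (Lang α) M N [] []
      same F LF s with Thy-complete α F LF
      ... | inj₁ F∈  = N⊨ F F∈
      ... | inj₂ ¬F∈ = ⊥-elim (M⊨ (¬' F) ¬F∈ s)

  -- Models of the theory at a level in the club.

  module Fiber {φ : Sentence τ} (D : SacksData τ φ) {κ : Ord} (κ∈C : C D κ) where
    open Branch (branch D)

    -- Both isomorphisms end in `M` because a Scott sentence of `M` provides them in this form. A
    -- realization in `B D κ` is sent forward to `M` and back to the atomic model `A D κ`.
    Aκ≇Bκ : ∀ {M} → A D κ ≅ M → B D κ ≅ M → ⊥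
    Aκ≇Bκ A≅M B≅M with A-type D κ
    ... | n , c , p-type , nonprincipal with B-types D κ∈C _ p-type nonprincipal
    ... | b , b⊨p = nonprincipal (IsPrincipal-resp-≐ (q⊆p , p⊆q)
                      (proj₂ (A-atomic D κ) n a))
      where
      a = map (Inverse.from (_≅_.bijection A≅M)) (map (_≅_.to B≅M) b)
      p = tp (Lang D κ) (A D (suc κ)) c
      q = tp (Lang D κ) (A D κ) a

      p⊆q : p ⊆ q
      p⊆q {F} (LF , s) =
        LF , Iso.Sat-≅⁻¹ A≅M F _ (to (Iso.Sat-≅ B≅M F b) (b⊨p F (LF , s)))

      q⊆p : q ⊆ p
      -- `p` is the type of a tuple: a formula of the language missing from `p` has its negation in
      -- `p`, hence in `q`.
      q⊆p {F} (LF , s) =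
        LF , dne λ ¬s → proj₂ (p⊆q {¬' F} (Lang-closed κ _ (¬' base LF) , ¬s)) s

    cSR≮κ : ∀ {M} → M ⊨ᵀ Thy D κ → IscSR M γ → ¬ γ < κ
    cSR≮κ {M = M} M⊨ ((F , ΠF , scott) , _) γ<κ =
      Aκ≇Bκ (copy (proj₁ (A-atomic D κ))) (copy (B-model D κ∈C))
      where
      copy : ∀ {N} → N ⊨ᵀ Thy D κ → N ≅ M
      -- Rank `γ` gives a Scott sentence in `Πin (suc γ)`, and `γ < κ` gives `suc γ ≤ κ`, so
      -- `≡[ κ ]` transfers it to `N`.
      copy {N} N⊨ = to (scott N) (to (⊨ᵀ⇒≡ M⊨ N⊨ F (Πin-raise (suc≤ γ<κ) ΠF))
                      (from (scott M) (≅-refl M)))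

    ⊨φ : ∀ {M} → M ⊨ᵀ Thy D κ → M ⊨ φ
    ⊨φ M⊨ = M⊨ φ (IsBranch.mono-thy (branch D) zero≤
      (IsRootNode.extends (IsBranch.root (branch D)) (inj₁ (≈-refl φ))))

    -- Were the `≡[ κ ]`-class of `M` countable, `M` would lie outside `𝒞 φ κ`, so its rank would be
    -- below the bound `β ≤ κ` given by `𝔉`.
    ⊨ᵀ⇒𝒞 : 𝔉 φ κ → ∀ {M} → M ⊨ᵀ Thy D κ → 𝒞 φ κ M
    ⊨ᵀ⇒𝒞 (β , (small-cSR , _) , β≤κ) {M} M⊨ = ⊨φ M⊨ , λ countable →
      let (γ , cSR≡γ , γ<β) = small-cSR M (⊨φ M⊨) (λ M∈𝒞 → proj₂ M∈𝒞 countable)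
      in cSR≮κ M⊨ cSR≡γ (<-≤-trans γ<β β≤κ)

mainTheorem9 : ExcludedMiddle 0ℓ →
    (τ : Vocabulary) (φ : Sentence τ) → MinimalCounterexample τ φ →
    (D : SacksData τ φ) (κ : Ord) → S° D κ →
    (∀ M → IsFiberModel D κ M → 𝒞 φ κ M)
    × (∀ M → IsFiberModel D κ M → M ≡[ κ ] B D κ)
    × (∀ M N → IsFiberModel D κ M → IsFiberModel D κ N → M ≡[ κ ] N)
mainTheorem9 em τ φ _ D κ (κ∈𝔉 , κ∈C , _) =
    (λ M (M⊨ , _) → ⊨ᵀ⇒𝒞 κ∈𝔉 M⊨)
  , (λ M (M⊨ , _) → ⊨ᵀ⇒≡ M⊨ (B-model D κ∈C))
  , (λ M N (M⊨ , _) (N⊨ , _) → ⊨ᵀ⇒≡ M⊨ N⊨)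
  where
  open Classical em
  open Branch (branch D)
  open Fiber D κ∈C
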